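{- For every integer $k\ge 1$, the number of plane symplectic wave graphs with vertex set $\{1,2,\dots,2k\}$ equals $$\frac{(2k)!\,(2k+2)!\cdot 6}{k!\,(k+1)!\,(k+2)!\,(k+3)!}.$$
   Context: A plane symplectic wave graph with vertex set $\{1,2,\dots,m\}$ is a simple graph on these vertices satisfying the following conditions. Each connected component is a path of length $\ge 1$ (no isolated vertices). If a component is the path with consecutive vertices $i_1,i_2,\dots,i_{l+1}$, then $i_1<i_2<\dots<i_{l+1}$. The graph can be drawn in the plane, viewed as the upper and lower open half-planes glued along the real line (vertices placed at the points $1,\dots,m$ of $\mathbb{R}$, each edge drawn as an arc inside one half-plane), so that: the first edge $\{i_1i_2\}$ of each component is drawn in the upper half-plane; each subsequent edge $\{i_ji_{j+1}\}$ is drawn in the half-plane opposite to the one containing the preceding edge $\{i_{j-1}i_j\}$; the last edge $\{i_li_{l+1}\}$ of each component is drawn in the upper half-plane; and no two edges intersect except at common endpoints. -}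

module Defs where

open import Data.Nat using (ℕ; _≤_)
open import Data.Bool using (Bool; T)
open import Data.Fin using (Fin; _<_)
open import Data.Vec using (Vec; lookup)
open import Data.List using (List; []; _∷_; length; concat; concatMap; allFin; last)
open import Data.Maybe using (Maybe; just; nothing)
open import Data.Product using (Σ; ∃; _×_; _,_)
open import Data.Sum using (_⊎_)
open import Data.List.Membership.Propositional using (_∈_)
open import Data.List.Relation.Unary.All using (All)
open import Data.List.Relation.Unary.Linked using (Linked)
open import Data.List.Relation.Unary.Unique.Propositional using (Unique)
open import Data.List.Relation.Binary.Permutation.Propositional using (_↭_)
open import Relation.Binary.PropositionalEquality using (_≡_)
open import Relation.Nullary using (¬_)
open import Function.Bundles using (_⇔_)

-- A simple graph on the vertex set Fin m is given by its adjacency matrix.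
-- Vertex i : Fin m stands for the integer (toℕ i + 1); the order is the same.
Graph : ℕ → Set
Graph m = Vec (Vec Bool m) m

Adjacent : ∀ {m} → Graph m → Fin m → Fin m → Set
Adjacent G i j = T (lookup (lookup G i) j)

data Side : Set where
  upper lower : Side

opposite : Side → Side
opposite upper = lower
opposite lower = upper

-- An edge {a,b} (a < b) together with the half-plane it is drawn in.
Edge : ℕ → Set
Edge m = Fin m × Fin m × Side

drawPath : ∀ {m} → Side → List (Fin m) → List (Edge m)
drawPath s (a ∷ b ∷ rest) = (a , b , s) ∷ drawPath (opposite s) (b ∷ rest)
drawPath s _ = []

edgeSide : ∀ {m} → Edge m → Side
edgeSide (_ , _ , s) = s

lastSide : ∀ {m} → Maybe (Edge m) → Maybe Side
lastSide nothing = nothing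
lastSide (just e) = just (edgeSide e)

ValidPath : ∀ {m} → List (Fin m) → Set
ValidPath p =
  (2 ≤ length p) × Linked _<_ p × lastSide (last (drawPath upper p)) ≡ just upper

-- Two arcs with endpoints on the real line drawn in the same open half-plane
-- must cross iff their endpoints strictly interleave (a < c < b < d).
Interleave : ∀ {m} → Fin m → Fin m → Fin m → Fin m → Set
Interleave a b c d = a < c × c < b × b < d

IsPSWG : ∀ {m} → Graph m → Set
IsPSWG {m} G = Σ (List (List (Fin m))) λ ps →
  let E = concatMap (drawPath upper) ps in
    (concat ps ↭ allFin m)
  × All ValidPath ps
  × (∀ i j → Adjacent G i j ⇔ (∃ λ s → ((i , j , s) ∈ E) ⊎ ((j , i , s) ∈ E)))
  × (∀ a b c d s → (a , b , s) ∈ E → (c , d , s) ∈ E → ¬ Interleave a b c d)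

HasCount : {A : Set} → (A → Set) → ℕ → Set
HasCount {A} P n = Σ (List A) λ xs →
  Unique xs × (∀ a → (a ∈ xs) ⇔ P a) × length xs ≡ n

{-# OPTIONS --safe #-}

-- Sweep a drawing from left to right, keeping the numbers u and l of upper and lower arcs
-- that are currently cut. A vertex starts a path (u + 1), ends one (u - 1), or continues one,
-- moving a unit from u to l or from l to u; planarity forces it to use the innermost arc, so
-- drawings correspond to walks in the quarter plane with these steps (Gouyou-Beauchamps
-- walks) from the origin to itself. In the coordinates (u + l, l) they stay in a Weyl chamber
-- of type C₂, and the walks of length n = u + 2l + 2m from (u, l) to the origin number
--   n! (n+2)! (u+1) (l+1) (u+l+2) (u+2l+3) / (m! (l+m+1)! (u+l+m+2)! (u+2l+m+3)!),
-- since after clearing the factorials the recursion on n is a polynomial identity.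
module Submission where

open import Defs
open import Data.Nat using (ℕ; _*_; _+_; _≤_; _!)
open import Data.Product using (Σ; _×_)
open import Relation.Binary.PropositionalEquality using (_≡_)

open import Data.Bool using (Bool; true; false; T)
open import Data.Empty using (⊥; ⊥-elim)
open import Data.Fin as Fin using (Fin; _<_)
import Data.Fin.Properties as Fin
open import Data.List using (List; []; _∷_; _++_; map; concat; concatMap; length; allFin; last)
import Data.List.Properties as List
import Data.List.Membership.DecPropositional as DecMembership
open import Data.List.Membership.Propositional using (_∈_; _∉_; find)
open import Data.List.Membership.Propositional.Properties
  using (∈-map⁺; ∈-map⁻; ∈-++⁺ˡ; ∈-++⁺ʳ; ∈-++⁻; ∈-∃++; ∈-concatMap⁺; ∈-concatMap⁻)
open import Data.List.Relation.Binary.Permutation.Propositional as Perm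
  using (_↭_; refl; prep; swap; ↭-trans; ↭-sym)
open import Data.List.Relation.Binary.Permutation.Propositional.Properties
  using (∈-resp-↭; All-resp-↭; ++⁺ˡ; ++⁺ʳ; map⁺; shift; shifts; drop-∷; ¬x∷xs↭[])
open import Data.List.Relation.Unary.All as All using (All; []; _∷_)
open import Data.List.Relation.Unary.AllPairs as AllPairs using (AllPairs; []; _∷_)
import Data.List.Relation.Unary.AllPairs.Properties as AllPairs
open import Data.List.Relation.Unary.Any as Any using (here; there)
open import Data.List.Relation.Unary.Linked as Linked using (Linked; []; [-]; _∷_)
open import Data.List.Relation.Unary.Linked.Properties using (Linked⇒AllPairs)
open import Data.List.Relation.Unary.Unique.Propositional using (Unique)
import Data.List.Relation.Unary.Unique.Propositional.Properties as Unique
open import Data.Maybe using (just)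
open import Data.Nat as ℕ using (zero; suc; z≤n; s≤s; s≤s⁻¹)
import Data.Nat.Properties as ℕ
open import Data.Nat.Properties
  using (+-suc; +-identityʳ; +-monoʳ-≤; *-zeroʳ; *-monoʳ-≤; *-distribʳ-+; suc-injective;
         ≤-trans; ≤-reflexive; <-trans; <-≤-trans; n≤1+n; n<1+n; m<n⇒m<1+n)
open import Data.Nat.Tactic.RingSolver using (solve-∀)
open import Data.Product using (∃; ∃₂; _,_; proj₁; proj₂)
import Data.Product.Properties as Product
open import Data.Sum using (_⊎_; inj₁; inj₂)
open import Data.Unit using (⊤; tt)
open import Data.Vec using (Vec; []; _∷_; toList; lookup; tabulate)
import Data.Vec.Properties as Vec
open import Function using (_∘_; _⇔_; mk⇔; Equivalence)
open import Function.Properties.Equivalence using () renaming (trans to ⇔-trans; sym to ⇔-sym)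
open import Relation.Binary.Definitions using (DecidableEquality)
open import Relation.Binary.PropositionalEquality
  using (_≢_; refl; sym; trans; cong; cong₂; subst; module ≡-Reasoning)
open import Relation.Nullary using (¬_; Dec; yes; no)
open import Relation.Nullary.Decidable using (⌊_⌋; toWitness; fromWitness; map′; _⊎-dec_)

private
  variable
    n m u l u′ l′ : ℕ
    v : Fin m
    vs : List (Fin m)
    s : Side

-- The number of walks

mutual
  count : ℕ → ℕ → ℕ → ℕ
  count zero    zero    zero    = 1
  count zero    zero    (suc _) = 0
  count zero    (suc _) _       = 0
  count (suc n) u       l       = count n (suc u) l + (closings n u l + ups n u l)

  closings : ℕ → ℕ → ℕ → ℕ
  closings n zero    l = 0
  closings n (suc u) l = count n u l + count n u (suc l)

  ups : ℕ → ℕ → ℕ → ℕ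
  ups n u zero    = 0
  ups n u (suc l) = count n (suc u) l

mutual
  -- Every step changes `u + 2 * l` by exactly one, and the walk must bring it to 0. An upper arc
  -- needs one more step to be absorbed, a lower one needs two, since it has to come back up first.
  count-short : ∀ n u l → n ℕ.< u + 2 * l → count n u l ≡ 0
  count-short zero    zero    (suc l) _  = refl
  count-short zero    (suc u) l       _  = refl
  count-short (suc n) u       l       n<
    rewrite count-short n (suc u) l (<-trans (n<1+n n) (m<n⇒m<1+n n<))
          | closings-short n u l n< | ups-short n u l n< = refl

  closings-short : ∀ n u l → suc n ℕ.< u + 2 * l → closings n u l ≡ 0
  closings-short n zero    l n< = refl
  closings-short n (suc u) l n<
    rewrite count-short n u l (s≤s⁻¹ n<)
          | count-short n u (suc l)
              (<-≤-trans (s≤s⁻¹ n<) (+-monoʳ-≤ u (*-monoʳ-≤ 2 (n≤1+n l)))) = refl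

  ups-short : ∀ n u l → suc n ℕ.< u + 2 * l → ups n u l ≡ 0
  ups-short n u zero    n< = refl
  ups-short n u (suc l) n< = count-short n (suc u) l (s≤s⁻¹ (subst (suc n ℕ.<_) (lemma u l) n<))
    where
    lemma : ∀ u l → u + 2 * suc l ≡ 2 + (u + 2 * l)
    lemma = solve-∀

-- Closed form for the number of walks

weight : ℕ → ℕ → ℕ → ℕ
weight u l m = (m !) * ((1 + (l + m)) !) * ((2 + (u + l + m)) !) * ((3 + (u + 2 * l + m)) !)

-- Six times the Weyl dimension formula for the irreducible representation of Sp(4) with highest
-- weight `(u , l)`, one factor for each positive root of C₂.
dim : ℕ → ℕ → ℕ
dim u l = (1 + u) * (1 + l) * (2 + (u + l)) * (3 + (u + 2 * l))

-- This and the next three lemmas compare the denominators before and after one step. Since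
-- `u + 2 * l + 2 * m` drops by one, `m` drops by one when the step raises `u + 2 * l` (start, down)
-- and stays when the step lowers it (end, up).
weight-start : ∀ u l m → weight u l (suc m) ≡ suc m * (2 + (l + m)) * weight (suc u) l m
weight-start u l m rewrite +-suc l m | +-suc (u + l) m | +-suc (u + 2 * l) m =
  lemma m (l + m) (m !) ((1 + (l + m)) !) ((3 + (u + l + m)) !) ((4 + (u + 2 * l + m)) !)
  where
  lemma : ∀ m x a b c d → (suc m * a) * ((2 + x) * b) * c * d ≡ suc m * (2 + x) * (a * b * c * d)
  lemma = solve-∀

weight-end : ∀ u l m → weight (suc u) l m ≡ (3 + (u + l + m)) * (4 + (u + 2 * l + m)) * weight u l m
weight-end u l m =
  lemma (u + l + m) (u + 2 * l + m) (m !) ((1 + (l + m)) !) ((2 + (u + l + m)) !) ((3 + (u + 2 * l + m)) !)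
  where
  lemma : ∀ x y a b c d → a * b * ((3 + x) * c) * ((4 + y) * d) ≡ (3 + x) * (4 + y) * (a * b * c * d)
  lemma = solve-∀

double-suc : ∀ u l m → u + 2 * suc l + m ≡ 2 + (u + 2 * l + m)
double-suc = solve-∀

weight-down : ∀ u l m → weight (suc u) l (suc m) ≡ suc m * (4 + (u + l + m)) * weight u (suc l) m
weight-down u l m rewrite +-suc l m | +-suc u l | +-suc (u + l) m | +-suc (u + 2 * l) m
                        | double-suc u l m =
  lemma m (u + l + m) (m !) ((2 + (l + m)) !) ((3 + (u + l + m)) !) ((5 + (u + 2 * l + m)) !)
  where
  lemma : ∀ m x a b c d → (suc m * a) * b * ((4 + x) * c) * d ≡ suc m * (4 + x) * (a * b * c * d)
  lemma = solve-∀

weight-up : ∀ u l m → weight u (suc l) m ≡ (2 + (l + m)) * (5 + (u + 2 * l + m)) * weight (suc u) l m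
weight-up u l m rewrite +-suc u l | double-suc u l m =
  lemma (l + m) (u + 2 * l + m) (m !) ((1 + (l + m)) !) ((3 + (u + l + m)) !) ((4 + (u + 2 * l + m)) !)
  where
  lemma : ∀ x y a b c d → a * ((2 + x) * b) * c * ((5 + y) * d) ≡ (2 + x) * (5 + y) * (a * b * c * d)
  lemma = solve-∀

-- The recursion on the length with the factorials cleared. The summands belong to start, finish,
-- down and up, each a ratio of denominators times `dim` at the new point. These values are written
-- out so that no subtraction occurs; the factors `m`, `u` and `l` kill the impossible steps, so one
-- identity also covers the boundary.
dim-recurrence : ∀ u l m →
    m * (1 + (l + m)) * ((2 + u) * (1 + l) * (2 + (1 + u + l)) * (3 + (1 + u + 2 * l)))
  + ((2 + (u + l + m)) * (3 + (u + 2 * l + m)) * (u * (1 + l) * (1 + (u + l)) * (2 + (u + 2 * l)))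
    + m * (2 + (u + l + m)) * (u * (2 + l) * (2 + (u + l)) * (4 + (u + 2 * l)))
    + (1 + (l + m)) * (3 + (u + 2 * l + m)) * ((2 + u) * l * (2 + (u + l)) * (2 + (u + 2 * l))))
  ≡ (u + 2 * l + 2 * m) * (2 + (u + 2 * l + 2 * m))
    * ((1 + u) * (1 + l) * (2 + (u + l)) * (3 + (u + 2 * l)))
dim-recurrence = solve-∀

-- Carries the induction hypothesis across a step: `f` is the ratio of the two denominators and ends
-- up beside the value `d` of `dim`.
transfer : ∀ c w′ F d f {w} → w ≡ f * w′ → c * w′ ≡ F * d → c * w ≡ F * (f * d)
transfer c w′ F d f refl eq = begin
  c * (f * w′)  ≡⟨ x*yz≡y*xz c f w′ ⟩
  f * (c * w′)  ≡⟨ cong (f *_) eq ⟩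
  f * (F * d)   ≡⟨ x*yz≡y*xz f F d ⟩
  F * (f * d)   ∎
  where
  open ≡-Reasoning
  x*yz≡y*xz : ∀ x y z → x * (y * z) ≡ y * (x * z)
  x*yz≡y*xz = solve-∀

-- Cross-multiplied to avoid division. The slack of `n` over `u + 2 * l` is written as `2 * m`,
-- which builds in its parity.
CountFormula : ℕ → Set
CountFormula n = ∀ u l m → n ≡ u + 2 * l + 2 * m →
  count n u l * weight u l m ≡ (n !) * ((2 + n) !) * dim u l

starts-formula : CountFormula n → ∀ u l m → suc n ≡ u + 2 * l + 2 * m →
  count n (suc u) l * weight u l m ≡ (n !) * ((2 + n) !) * (m * (1 + (l + m)) * dim (suc u) l)
starts-formula {n} ih u l zero eq
  -- Without slack, one more upper arc cannot be closed in the `n` steps left.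
  rewrite count-short n (suc u) l
            (≤-trans (≤-reflexive (trans eq (+-identityʳ _))) (n≤1+n _)) =
  sym (*-zeroʳ ((n !) * ((2 + n) !)))
starts-formula {n} ih u l (suc m) eq =
  transfer (count n (suc u) l) (weight (suc u) l m) ((n !) * ((2 + n) !)) (dim (suc u) l)
    (suc m * (1 + (l + suc m)))
    (trans (weight-start u l m)
      (cong (λ x → suc m * (1 + x) * weight (suc u) l m) (sym (+-suc l m))))
    (ih (suc u) l m (suc-injective (trans eq (lemma u l m))))
  where
  lemma : ∀ u l m → u + 2 * l + 2 * suc m ≡ suc (suc u + 2 * l + 2 * m)
  lemma = solve-∀

closings-formula : CountFormula n → ∀ u l m → suc n ≡ u + 2 * l + 2 * m →
  closings n u l * weight u l m ≡ (n !) * ((2 + n) !) *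
    ( (2 + (u + l + m)) * (3 + (u + 2 * l + m)) * (u * (1 + l) * (1 + (u + l)) * (2 + (u + 2 * l)))
    + m * (2 + (u + l + m)) * (u * (2 + l) * (2 + (u + l)) * (4 + (u + 2 * l))))
closings-formula {n} ih zero l m eq =
  sym (trans (cong ((n !) * ((2 + n) !) *_) (lemma (2 + (l + m)) (3 + (2 * l + m)) m))
             (*-zeroʳ ((n !) * ((2 + n) !))))
  where
  lemma : ∀ x y m → x * y * 0 + m * x * 0 ≡ 0
  lemma = solve-∀
closings-formula {n} ih (suc u) l m eq = begin
  (count n u l + count n u (suc l)) * weight (suc u) l m
    ≡⟨ *-distribʳ-+ (weight (suc u) l m) (count n u l) (count n u (suc l)) ⟩
  count n u l * weight (suc u) l m + count n u (suc l) * weight (suc u) l m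
    ≡⟨ cong₂ _+_
         (transfer (count n u l) (weight u l m) F (dim u l)
           ((3 + (u + l + m)) * (4 + (u + 2 * l + m)))
           (weight-end u l m) (ih u l m (suc-injective eq)))
         (downs m eq) ⟩
  F * ((3 + (u + l + m)) * (4 + (u + 2 * l + m)) * dim u l) + F * (m * (3 + (u + l + m)) * d′)
    ≡⟨ lemma F _ _ ⟩
  _ ∎
  where
  open ≡-Reasoning
  F = (n !) * ((2 + n) !)
  d′ = suc u * (2 + l) * (3 + (u + l)) * (5 + (u + 2 * l))
  lemma : ∀ x y z → x * y + x * z ≡ x * (y + z)
  lemma = solve-∀
  dim-suc : ∀ u l → (1 + u) * (2 + l) * (2 + (u + (1 + l))) * (3 + (u + 2 * (1 + l)))
    ≡ (1 + u) * (2 + l) * (3 + (u + l)) * (5 + (u + 2 * l))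
  dim-suc = solve-∀
  downs : ∀ m → suc n ≡ suc u + 2 * l + 2 * m →
    count n u (suc l) * weight (suc u) l m ≡ F * (m * (3 + (u + l + m)) * d′)
  -- Without slack a move down overshoots: `u + 2 * l` steps are left, but the new point needs
  -- `u + 2 * l + 2`.
  downs zero eq =
    trans (cong (_* weight (suc u) l zero) (count-short n u (suc l) n<)) (sym (*-zeroʳ F))
    where
    2+[u+2l] : ∀ u l → 2 + (u + 2 * l) ≡ u + 2 * suc l
    2+[u+2l] = solve-∀
    n< : n ℕ.< u + 2 * suc l
    n< = ≤-trans (≤-reflexive (trans eq (+-identityʳ _)))
           (≤-trans (n≤1+n _) (≤-reflexive (2+[u+2l] u l)))
  downs (suc m) eq =
    transfer (count n u (suc l)) (weight u (suc l) m) F d′ (suc m * (3 + (u + l + suc m)))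
      (trans (weight-down u l m)
        (cong (λ x → suc m * (3 + x) * weight u (suc l) m) (sym (+-suc (u + l) m))))
      (trans (ih u (suc l) m (suc-injective (trans eq (length-eq u l m))))
        (cong (F *_) (dim-suc u l)))
    where
    length-eq : ∀ u l m → suc u + 2 * l + 2 * suc m ≡ suc (u + 2 * suc l + 2 * m)
    length-eq = solve-∀

ups-formula : CountFormula n → ∀ u l m → suc n ≡ u + 2 * l + 2 * m →
  ups n u l * weight u l m ≡ (n !) * ((2 + n) !) *
    ((1 + (l + m)) * (3 + (u + 2 * l + m)) * ((2 + u) * l * (2 + (u + l)) * (2 + (u + 2 * l))))
ups-formula {n} ih u zero m eq =
  sym (trans (cong ((n !) * ((2 + n) !) *_) (lemma m u)) (*-zeroʳ ((n !) * ((2 + n) !))))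
  where
  lemma : ∀ m u → (1 + (0 + m)) * (3 + (u + 2 * 0 + m))
    * ((2 + u) * 0 * (2 + (u + 0)) * (2 + (u + 2 * 0))) ≡ 0
  lemma = solve-∀
ups-formula {n} ih u (suc l) m eq =
  transfer (count n (suc u) l) (weight (suc u) l m) ((n !) * ((2 + n) !))
    ((2 + u) * suc l * (2 + (u + suc l)) * (2 + (u + 2 * suc l)))
    ((2 + (l + m)) * (3 + (u + 2 * suc l + m)))
    (trans (weight-up u l m)
      (cong (λ x → (2 + (l + m)) * x * weight (suc u) l m) (factor-eq u l m)))
    (trans (ih (suc u) l m (suc-injective (trans eq (length-eq u l m))))
      (cong ((n !) * ((2 + n) !) *_) (dim-suc u l)))
  where
  factor-eq : ∀ u l m → 5 + (u + 2 * l + m) ≡ 3 + (u + 2 * suc l + m)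
  factor-eq = solve-∀
  length-eq : ∀ u l m → u + 2 * suc l + 2 * m ≡ suc (suc u + 2 * l + 2 * m)
  length-eq = solve-∀
  dim-suc : ∀ u l → (2 + u) * (1 + l) * (2 + (1 + u + l)) * (3 + (1 + u + 2 * l))
    ≡ (2 + u) * suc l * (2 + (u + suc l)) * (2 + (u + 2 * suc l))
  dim-suc = solve-∀

count-formula : ∀ n → CountFormula n
-- Length zero leaves only the origin, where both sides are 12.
count-formula zero zero zero zero refl = refl
count-formula (suc n) u l m eq = begin
  (count n (suc u) l + (closings n u l + ups n u l)) * weight u l m
    ≡⟨ distrib (count n (suc u) l) (closings n u l) (ups n u l) (weight u l m) ⟩
  count n (suc u) l * weight u l m + (closings n u l * weight u l m + ups n u l * weight u l m)
    ≡⟨ cong₂ _+_ (starts-formula ih u l m eq)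
         (cong₂ _+_ (closings-formula ih u l m eq) (ups-formula ih u l m eq)) ⟩
  _
    ≡⟨ trans (collect ((n !) * ((2 + n) !)) _ _ _)
         (cong ((n !) * ((2 + n) !) *_) (dim-recurrence u l m)) ⟩
  (n !) * ((2 + n) !) * ((u + 2 * l + 2 * m) * (2 + (u + 2 * l + 2 * m)) * dim u l)
    ≡⟨ cong (λ N → (n !) * ((2 + n) !) * (N * (2 + N) * dim u l)) eq ⟨
  (n !) * ((2 + n) !) * (suc n * (3 + n) * dim u l)
    ≡⟨ regroup n (n !) ((2 + n) !) (dim u l) ⟩
  (suc n !) * ((3 + n) !) * dim u l ∎
  where
  open ≡-Reasoning
  ih = count-formula n
  distrib : ∀ x y z w → (x + (y + z)) * w ≡ x * w + (y * w + z * w)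
  distrib = solve-∀
  collect : ∀ F x y z → F * x + (F * y + F * z) ≡ F * (x + (y + z))
  collect = solve-∀
  regroup : ∀ n a b d → a * b * (suc n * (3 + n) * d) ≡ (suc n * a) * ((3 + n) * b) * d
  regroup = solve-∀

-- Drawings cut by a vertical line

Path : ℕ → Set
Path m = Fin m × List (Fin m)

vertices : Path m → List (Fin m)
vertices (h , t) = h ∷ t

-- A path together with the half-plane of its first edge (for a one-vertex
-- path, the half-plane its first edge would use).
Strand : ℕ → Set
Strand m = Side × Path m

-- A drawing cut by a vertical line, seen from the right: the paths cut in an
-- upper arc and those cut in a lower arc, innermost arc first, and the paths
-- lying entirely to the right of the line.
State : ℕ → ℕ → ℕ → Set
State m u l = Vec (Path m) u × Vec (Path m) l × List (Path m)

-- Sides alternate along a path, so a path cut in an upper arc continues to the right with a lower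
-- edge, and conversely.
strands : State m u l → List (Strand m)
strands (us , ls , ds) =
  map (upper ,_) ds ++ map (lower ,_) (toList us) ++ map (upper ,_) (toList ls)

verts : List (Strand m) → List (Fin m)
verts = concatMap (vertices ∘ proj₂)

arcs : List (Strand m) → List (Edge m)
arcs = concatMap (λ q → drawPath (proj₁ q) (vertices (proj₂ q)))

heads : Side → State m u l → List (Fin m)
heads upper (us , _ , _) = map proj₁ (toList us)
heads lower (_ , ls , _) = map proj₁ (toList ls)

-- The four moves undo the steps of the sweep: from the drawing to the right of `v` they build the
-- one that includes `v`, touching only the innermost cut arcs.
startAt : Fin m → State m (suc u) l → State m u l
startAt v (p ∷ us , ls , ds) = us , ls , (v , vertices p) ∷ ds

finishAt : Fin m → State m u l → State m (suc u) l
finishAt v (us , ls , ds) = (v , []) ∷ us , ls , ds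

downAt : Fin m → State m u (suc l) → State m (suc u) l
downAt v (us , p ∷ ls , ds) = (v , vertices p) ∷ us , ls , ds

upAt : Fin m → State m (suc u) l → State m u (suc l)
upAt v (p ∷ us , ls , ds) = us , (v , vertices p) ∷ ls , ds

concatMap-↭ : {A B : Set} (f : A → List B) {xs ys : List A} →
  xs ↭ ys → concatMap f xs ↭ concatMap f ys
concatMap-↭ f refl          = refl
concatMap-↭ f (prep x p)    = ++⁺ˡ (f x) (concatMap-↭ f p)
concatMap-↭ f (swap x y p)  =
  ↭-trans (shifts (f x) (f y)) (++⁺ˡ (f y) (++⁺ˡ (f x) (concatMap-↭ f p)))
concatMap-↭ f (Perm.trans p q) = ↭-trans (concatMap-↭ f p) (concatMap-↭ f q)

-- The side is that of the next edge. A path may stop only where the next edge would be lower, that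
-- is, right after an upper one.
Ends : Side → List (Fin m) → Set
Ends s     (_ ∷ t) = Ends (opposite s) t
Ends upper []      = ⊥
Ends lower []      = ⊤

Proper : Strand m → Set
Proper (s , h , t) = Linked _<_ (h ∷ t) × Ends s t

record Tidy (vs : List (Fin m)) (qs : List (Strand m)) : Set where
  field
    covers : verts qs ↭ vs
    proper : All Proper qs

-- The arcs of E in half-plane s, together with arcs coming from the far left
-- that end at hs (innermost first), do not cross.
record Planar (s : Side) (E : List (Edge m)) (hs : List (Fin m)) : Set where
  field
    uncrossed : ∀ {a b c d} → (a , b , s) ∈ E → (c , d , s) ∈ E → ¬ Interleave a b c d
    nested    : AllPairs Fin._≤_ hs
    visible   : ∀ {a b h} → h ∈ hs → (a , b , s) ∈ E → a < h → ¬ h < b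

record Good (vs : List (Fin m)) (st : State m u l) : Set where
  field
    tidy   : Tidy vs (strands st)
    planar : ∀ s → Planar s (arcs (strands st)) (heads s st)

open Tidy
open Planar
open Good

tidy-resp-↭ : {qs rs : List (Strand m)} → qs ↭ rs → Tidy vs qs → Tidy vs rs
tidy-resp-↭ q↭r t .covers = ↭-trans (↭-sym (concatMap-↭ _ q↭r)) (t .covers)
tidy-resp-↭ q↭r t .proper = All-resp-↭ q↭r (t .proper)

tail∈-drawPath : ∀ {a b : Fin m} {s} s′ p → (a , b , s) ∈ drawPath s′ p → a ∈ p
tail∈-drawPath s′ (_ ∷ _ ∷ p) (here refl) = here refl
tail∈-drawPath s′ (_ ∷ x ∷ p) (there e)   = there (tail∈-drawPath (opposite s′) (x ∷ p) e)

tail∈-arcs : ∀ {a b : Fin m} {s} qs → (a , b , s) ∈ arcs qs → a ∈ verts qs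
tail∈-arcs qs e =
  ∈-concatMap⁺ _ (Any.map (λ {q} → tail∈-drawPath (proj₁ q) (vertices (proj₂ q)))
                          (∈-concatMap⁻ _ {xs = qs} e))

head-path : ∀ {n} {h : Fin m} (ps : Vec (Path m) n) →
  h ∈ map proj₁ (toList ps) → ∃ λ t → (h , t) ∈ toList ps
head-path ps h∈ with (_ , t) , p∈ , refl ← ∈-map⁻ proj₁ h∈ = t , p∈

head∈-verts : ∀ {h : Fin m} s (st : State m u l) → h ∈ heads s st → h ∈ verts (strands st)
head∈-verts {h = h} s st@(us , ls , ds) h∈ =
  ∈-concatMap⁺ _ (Any.map (λ { refl → here refl }) (proj₂ (proj₂ (strand s h∈))))
  where
  strand : ∀ s → h ∈ heads s st → ∃₂ λ s′ t → (s′ , h , t) ∈ strands st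
  strand upper h∈ with t , p∈ ← head-path us h∈ =
    lower , t , ∈-++⁺ʳ (map _ ds) (∈-++⁺ˡ (∈-map⁺ _ p∈))
  strand lower h∈ with t , p∈ ← head-path ls h∈ =
    upper , t , ∈-++⁺ʳ (map _ ds) (∈-++⁺ʳ (map _ (toList us)) (∈-map⁺ _ p∈))

-- Adding and removing the leftmost vertex

Below : Fin m → List (Edge m) → Set
Below v E = ∀ {a b s} → (a , b , s) ∈ E → v < a

arcs-above : All (v <_) vs → (st : State m u l) → Tidy vs (strands st) →
  Below v (arcs (strands st))
arcs-above v<vs st t e =
  All.lookup v<vs (∈-resp-↭ (t .covers) (tail∈-arcs (strands st) e))

heads-above : All (v <_) vs → (st : State m u l) → Tidy vs (strands st) →
  ∀ {h} s → h ∈ heads s st → v < h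
heads-above v<vs st t s h∈ =
  All.lookup v<vs (∈-resp-↭ (t .covers) (head∈-verts s st h∈))

opposite-≢ : ∀ s → opposite s ≢ s
opposite-≢ upper ()
opposite-≢ lower ()

by-sides : {P : Side → Set} → ∀ s → P s → P (opposite s) → ∀ s′ → P s′
by-sides upper p q upper = p
by-sides upper p q lower = q
by-sides lower p q upper = q
by-sides lower p q lower = p

module _ {s : Side} {E : List (Edge m)} {hs : List (Fin m)} where

  planar-resp : {E′ : List (Edge m)} → (∀ {a b} → (a , b , s) ∈ E′ → (a , b , s) ∈ E) →
    Planar s E hs → Planar s E′ hs
  planar-resp E′⊆E p .uncrossed e e′  = p .uncrossed (E′⊆E e) (E′⊆E e′)
  planar-resp E′⊆E p .nested          = p .nested
  planar-resp E′⊆E p .visible h∈ e    = p .visible h∈ (E′⊆E e)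

  -- Everything else lies to the right of `v`, so a cut arc ending at `v` is innermost and no drawn
  -- arc passes over `v`.
  planar-open : Below v E → (∀ {h} → h ∈ hs → v < h) →
    Planar s E hs → Planar s E (v ∷ hs)
  planar-open below above p .uncrossed = p .uncrossed
  planar-open below above p .nested = All.tabulate (ℕ.<⇒≤ ∘ above) ∷ p .nested
  planar-open below above p .visible (here refl) e a<v _ = Fin.<-asym (below e) a<v
  planar-open below above p .visible (there h∈) = p .visible h∈

  planar-drop : ∀ {v} → Planar s E (v ∷ hs) → Planar s E hs
  planar-drop p .uncrossed  = p .uncrossed
  planar-drop p .nested     with _ ∷ ns ← p .nested = ns
  planar-drop p .visible h∈ = p .visible (there h∈)

  -- The left end of the innermost cut arc is pulled in from the far left to `v`. An arc of `E`
  -- crossing the result would have hidden `h`, and a cut arc ending underneath it would contradict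
  -- nesting.
  planar-join : ∀ {h} → Below v E → Planar s E (h ∷ hs) → Planar s ((v , h , s) ∷ E) hs
  planar-join {v} {h} below p = record
    { uncrossed = uncrossed′ ; nested = planar-drop p .nested ; visible = visible′ }
    where
    uncrossed′ : ∀ {a b c d} → (a , b , s) ∈ (v , h , s) ∷ E → (c , d , s) ∈ (v , h , s) ∷ E →
      ¬ Interleave a b c d
    uncrossed′ (here refl) (here refl) (v<v , _)           = Fin.<-irrefl refl v<v
    uncrossed′ (here refl) (there e)   (_ , c<h , h<d)     = p .visible (here refl) e c<h h<d
    uncrossed′ (there e)   (here refl) (a<v , _)           = Fin.<-asym (below e) a<v
    uncrossed′ (there e)   (there e′)                      = p .uncrossed e e′
    visible′ : ∀ {a b h′} → h′ ∈ hs → (a , b , s) ∈ (v , h , s) ∷ E → a < h′ → ¬ h′ < b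
    visible′ h′∈ (here refl) _ h′<h with h≤ ∷ _ ← p .nested =
      ℕ.<⇒≱ h′<h (All.lookup h≤ h′∈)
    visible′ h′∈ (there e) = p .visible (there h′∈) e

  -- Converse of `planar-join`: the arc from `v` to `h` is stretched to the far left. As nothing
  -- else begins or ends left of `v`, what it crossed before and after is the same.
  planar-cut : ∀ {h} → Below v E → (∀ {h′} → h′ ∈ hs → v < h′) →
    Planar s ((v , h , s) ∷ E) hs → Planar s E (h ∷ hs)
  planar-cut below above p .uncrossed e e′ = p .uncrossed (there e) (there e′)
  planar-cut below above p .nested =
    All.tabulate (λ h′∈ → ℕ.≮⇒≥ (p .visible h′∈ (here refl) (above h′∈))) ∷ p .nested
  planar-cut below above p .visible (here refl) e a<h h<b =
    p .uncrossed (here refl) (there e) (below e , a<h , h<b)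
  planar-cut below above p .visible (there h∈) e = p .visible h∈ (there e)

incoming : Bool → Fin m → List (Fin m)
incoming true  v = v ∷ []
incoming false v = []

-- st′ results from st when v becomes the left end of the innermost cut arc on side s. If
-- b = true, then v also ends an arc on the opposite side, which becomes the innermost there.
record Attached (v : Fin m) (s : Side) (b : Bool)
                (st : State m u l) (st′ : State m u′ l′) : Set where
  field
    {next}      : Fin m
    {later}     : List (Fin m)
    {rest}      : List (Strand m)
    before      : strands st ↭ (opposite s , next , later) ∷ rest
    after       : strands st′ ↭ (s , v , next ∷ later) ∷ rest
    heads-same  : heads s st ≡ next ∷ heads s st′
    heads-other : heads (opposite s) st′ ≡ incoming b v ++ heads (opposite s) st

open Attached

strands-upper : ∀ (p : Path m) (us : Vec (Path m) u) (ls : Vec (Path m) l) ds →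
  strands (p ∷ us , ls , ds) ↭ (lower , p) ∷ strands (us , ls , ds)
strands-upper p us ls ds = shift (lower , p) (map _ ds) _

strands-lower : ∀ (p : Path m) (us : Vec (Path m) u) (ls : Vec (Path m) l) ds →
  strands (us , p ∷ ls , ds) ↭ (upper , p) ∷ strands (us , ls , ds)
strands-lower p us ls ds =
  ↭-trans (++⁺ˡ (map _ ds) (shift (upper , p) (map _ (toList us)) _))
          (shift (upper , p) (map _ ds) _)

start-attached : ∀ v (st : State m (suc u) l) → Attached v upper false st (startAt v st)
start-attached v (p ∷ us , ls , ds) = record
  { before = strands-upper p us ls ds ; after = refl ; heads-same = refl ; heads-other = refl }

down-attached : ∀ v (st : State m u (suc l)) → Attached v lower true st (downAt v st)
down-attached v (us , p ∷ ls , ds) = record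
  { before = strands-lower p us ls ds ; after = strands-upper _ us ls ds
  ; heads-same = refl ; heads-other = refl }

up-attached : ∀ v (st : State m (suc u) l) → Attached v upper true st (upAt v st)
up-attached v (p ∷ us , ls , ds) = record
  { before = strands-upper p us ls ds ; after = strands-lower _ us ls ds
  ; heads-same = refl ; heads-other = refl }

module _ {v : Fin m} {b} {st : State m u l} {st′ : State m u′ l′} (att : Attached v s b st st′) where

  attached-arcs : arcs (strands st′) ↭ (v , att .next , s) ∷ arcs (strands st)
  attached-arcs = ↭-trans (concatMap-↭ _ (att .after))
                          (prep _ (↭-sym (concatMap-↭ _ (att .before))))

  other-arcs : ∀ {a b s′} → s′ ≡ opposite s →
    (a , b , s′) ∈ arcs (strands st′) → (a , b , s′) ∈ arcs (strands st)
  other-arcs s′≡ e with ∈-resp-↭ attached-arcs e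
  ... | here refl = ⊥-elim (opposite-≢ s (sym s′≡))
  ... | there e′  = e′

  -- On side `s` the innermost cut arc becomes a drawn arc. On the other side no arc is drawn; at
  -- most a new cut arc ending at `v` appears.
  attached-good : All (v <_) vs → Good vs st → Good (v ∷ vs) st′
  attached-good {vs = vs} v<vs g = record
    { tidy   = tidy-resp-↭ (↭-sym (att .after)) record
        { covers = prep v (tb .covers)
        ; proper = proper′ (tb .proper)
        }
    ; planar = by-sides s
        (planar-resp (∈-resp-↭ attached-arcs)
          (planar-join below (subst (Planar s _) (att .heads-same) (g .planar s))))
        (planar-resp (other-arcs refl)
          (subst (Planar _ _) (sym (att .heads-other))
            (opened b (g .planar (opposite s)))))
    }
    where
    tb = tidy-resp-↭ (att .before) (g .tidy)
    below = arcs-above v<vs st (g .tidy)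
    v<h : v < att .next
    v<h = All.lookup v<vs (∈-resp-↭ (tb .covers) (here refl))
    proper′ : All Proper ((opposite s , att .next , att .later) ∷ att .rest) →
      All Proper ((s , v , att .next ∷ att .later) ∷ att .rest)
    -- `ends` is passed on unchanged because `Ends s` on a nonempty list unfolds to
    -- `Ends (opposite s)` on its tail.
    proper′ ((lk , ends) ∷ ps) = ((v<h ∷ lk) , ends) ∷ ps
    opened : ∀ b → Planar (opposite s) (arcs (strands st)) (heads (opposite s) st) →
      Planar (opposite s) (arcs (strands st)) (incoming b v ++ heads (opposite s) st)
    opened true  = planar-open below (heads-above v<vs st (g .tidy) (opposite s))
    opened false p = p

  detached-good : All (v <_) vs → Good (v ∷ vs) st′ → Good vs st
  detached-good {vs = vs} v<vs g = record
    { tidy   = td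
    ; planar = by-sides s
        (subst (Planar s _) (sym (att .heads-same))
          (planar-cut below
            (λ h∈ → heads-above v<vs st td s (subst (_ ∈_) (sym (att .heads-same)) (there h∈)))
            (planar-resp (∈-resp-↭ (↭-sym attached-arcs)) (g .planar s))))
        (closed b (planar-resp (∈-resp-↭ (↭-sym attached-arcs) ∘ there)
          (subst (Planar _ _) (att .heads-other) (g .planar (opposite s)))))
    }
    where
    ta = tidy-resp-↭ (att .after) (g .tidy)
    proper′ : All Proper ((s , v , att .next ∷ att .later) ∷ att .rest) →
      All Proper ((opposite s , att .next , att .later) ∷ att .rest)
    proper′ ((lk , ends) ∷ ps) = (Linked.tail lk , ends) ∷ ps
    td : Tidy vs (strands st)
    td = tidy-resp-↭ (↭-sym (att .before)) record
      { covers = drop-∷ (ta .covers) ; proper = proper′ (ta .proper) }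
    below = arcs-above v<vs st td
    closed : ∀ b {E} → Planar (opposite s) E (incoming b v ++ heads (opposite s) st) →
      Planar (opposite s) E (heads (opposite s) st)
    closed true  = planar-drop
    closed false p = p

-- The new strand has one vertex and carries no arc, which is why finishing is kept apart from
-- `Attached`.
finish-arcs : ∀ v (st : State m u l) → arcs (strands (finishAt v st)) ↭ arcs (strands st)
finish-arcs v (us , ls , ds) = concatMap-↭ _ (strands-upper _ us ls ds)

finish-good : All (v <_) vs → (st : State m u l) → Good vs st → Good (v ∷ vs) (finishAt v st)
finish-good {v = v} v<vs st@(us , ls , ds) g = record
  { tidy   = tidy-resp-↭ (↭-sym (strands-upper _ us ls ds)) record
      { covers = prep v (g .tidy .covers) ; proper = ([-] , tt) ∷ g .tidy .proper }
  ; planar = λ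
      { upper → planar-resp (∈-resp-↭ (finish-arcs v st))
                  (planar-open (arcs-above v<vs st (g .tidy))
                    (heads-above v<vs st (g .tidy) upper) (g .planar upper))
      ; lower → planar-resp (∈-resp-↭ (finish-arcs v st)) (g .planar lower) }
  }

unfinish-good : (st : State m u l) → Good (v ∷ vs) (finishAt v st) → Good vs st
unfinish-good {v = v} st@(us , ls , ds) g = record
  { tidy   = record { covers = drop-∷ (t .covers) ; proper = All.tail (t .proper) }
  ; planar = λ
      { upper → planar-resp (∈-resp-↭ (↭-sym (finish-arcs v st))) (planar-drop (g .planar upper))
      ; lower → planar-resp (∈-resp-↭ (↭-sym (finish-arcs v st))) (g .planar lower) }
  }
  where
  t = tidy-resp-↭ (strands-upper _ us ls ds) (g .tidy)

-- Walks and drawings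

-- The list holds the vertices not yet swept, and `(u , l)` counts the arcs cut just before them, so
-- the walk leads from there to the origin. Keeping the vertices themselves, not only their number,
-- lets `decode` label the drawing.
data Walk {m} : List (Fin m) → ℕ → ℕ → Set where
  nil    : Walk [] 0 0
  start  : Walk vs (suc u) l → Walk (v ∷ vs) u l
  finish : Walk vs u l → Walk (v ∷ vs) (suc u) l
  down   : Walk vs u (suc l) → Walk (v ∷ vs) (suc u) l
  up     : Walk vs (suc u) l → Walk (v ∷ vs) u (suc l)

decode : {vs : List (Fin m)} → Walk vs u l → State m u l
decode nil                = [] , [] , []
decode (start {v = v} w)  = startAt v (decode w)
decode (finish {v = v} w) = finishAt v (decode w)
decode (down {v = v} w)   = downAt v (decode w)
decode (up {v = v} w)     = upAt v (decode w)

decode-good : AllPairs _<_ vs → (w : Walk vs u l) → Good vs (decode w)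
decode-good []            nil        = record
  { tidy   = record { covers = refl ; proper = [] }
  ; planar = λ { upper → empty ; lower → empty } }
  where
  empty : ∀ {m s} → Planar {m} s [] []
  empty = record { uncrossed = λ () ; nested = [] ; visible = λ () }
decode-good (v<vs ∷ <vs) (start w) =
  attached-good (start-attached _ (decode w)) v<vs (decode-good <vs w)
decode-good (v<vs ∷ <vs) (finish w) =
  finish-good v<vs (decode w) (decode-good <vs w)
decode-good (v<vs ∷ <vs) (down w) =
  attached-good (down-attached _ (decode w)) v<vs (decode-good <vs w)
decode-good (v<vs ∷ <vs) (up w) =
  attached-good (up-attached _ (decode w)) v<vs (decode-good <vs w)

-- From drawings back to walks

head-minimal : All (v <_) vs → ∀ {h} → h ∈ v ∷ vs → v Fin.≤ h
head-minimal v<vs (here refl) = ℕ.≤-refl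
head-minimal v<vs (there h∈)  = ℕ.<⇒≤ (All.lookup v<vs h∈)

least-first : ∀ {h hs} → AllPairs Fin._≤_ (h ∷ hs) → v Fin.≤ h → v ∈ h ∷ hs → v ≡ h
least-first _          v≤h (here v≡h) = v≡h
least-first (h≤hs ∷ _) v≤h (there v∈) = Fin.≤-antisym v≤h (All.lookup h≤hs v∈)

-- `v` lies on some strand. The head of that strand is at least `v`, as `v` is the least vertex, and
-- at most `v`, as strands increase.
path-from : AllPairs _<_ (v ∷ vs) → {qs : List (Strand m)} → Tidy (v ∷ vs) qs →
  ∃₂ λ s t → (s , v , t) ∈ qs
path-from {v = v} (v<vs ∷ _) {qs} tidy′
  with (s , h , t) , q∈ , v∈ ← find (∈-concatMap⁻ _ {xs = qs}
         (∈-resp-↭ (↭-sym (tidy′ .covers)) (here refl)))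
  with refl ← least-first
    (AllPairs.map ℕ.<⇒≤ (Linked⇒AllPairs Fin.<-trans (proj₁ (All.lookup (tidy′ .proper) q∈))))
    (head-minimal v<vs
      (∈-resp-↭ (tidy′ .covers) (∈-concatMap⁺ _ (Any.map (λ { refl → here refl }) q∈))))
    v∈
  = s , t , q∈

locate : AllPairs _<_ (v ∷ vs) → ∀ (us : Vec (Path m) u) (ls : Vec (Path m) l) ds →
  Good (v ∷ vs) (us , ls , ds) →
  (∃ λ t → (v , t) ∈ ds) ⊎ v ∈ heads upper (us , ls , ds) ⊎ v ∈ heads lower (us , ls , ds)
locate <vs us ls ds g with path-from <vs (g .tidy)
... | _ , _ , q∈ with ∈-++⁻ (map _ ds) q∈
... | inj₁ q∈ds with _ , p∈ , refl ← ∈-map⁻ _ q∈ds = inj₁ (_ , p∈)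
... | inj₂ q∈us++ls with ∈-++⁻ (map _ (toList us)) q∈us++ls
... | inj₁ q∈us with _ , p∈ , refl ← ∈-map⁻ _ q∈us = inj₂ (inj₁ (∈-map⁺ proj₁ p∈))
... | inj₂ q∈ls with _ , p∈ , refl ← ∈-map⁻ _ q∈ls = inj₂ (inj₂ (∈-map⁺ proj₁ p∈))

good-resp-↭ : ∀ {us : Vec (Path m) u} {ls : Vec (Path m) l} {ds ds′} → ds ↭ ds′ →
  Good vs (us , ls , ds) → Good vs (us , ls , ds′)
good-resp-↭ {us = us} {ls} {ds} {ds′} ds↭ g = record
  { tidy = tidy-resp-↭ strands↭ (g .tidy)
  ; planar = λ
      { upper → planar-resp (∈-resp-↭ (↭-sym (concatMap-↭ _ strands↭))) (g .planar upper)
      ; lower → planar-resp (∈-resp-↭ (↭-sym (concatMap-↭ _ strands↭))) (g .planar lower) }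
  }
  where
  strands↭ : strands (us , ls , ds) ↭ strands (us , ls , ds′)
  strands↭ = ++⁺ʳ _ (map⁺ _ ds↭)

-- `decode` lists the whole paths in the order of their first vertices, so an arbitrary list of them
-- is recovered only up to permutation.
Decoding : (vs : List (Fin m)) → State m u l → Set
Decoding {u = u} {l} vs (us , ls , ds) =
  Σ (Walk vs u l) λ w → ∃ λ ds′ → decode w ≡ (us , ls , ds′) × ds ↭ ds′

-- Peel off the least vertex `v`. If it heads a whole path, it starts one. Otherwise it ends a cut
-- arc, which is innermost because the heads are nested; on the upper side the path either finishes
-- at `v` or goes down, on the lower side it must go up.
decoding : AllPairs _<_ vs → ∀ (us : Vec (Path m) u) (ls : Vec (Path m) l) ds →
  Good vs (us , ls , ds) → Decoding vs (us , ls , ds)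
decoding [] [] [] [] g = nil , [] , refl , refl
decoding [] us@(_ ∷ _) ls ds g
  with () ← ∈-resp-↭ (g .tidy .covers) (head∈-verts upper (us , ls , ds) (here refl))
decoding [] us ls@(_ ∷ _) ds g
  with () ← ∈-resp-↭ (g .tidy .covers) (head∈-verts lower (us , ls , ds) (here refl))
decoding [] [] [] (_ ∷ ds) g = ⊥-elim (¬x∷xs↭[] (g .tidy .covers))
decoding {vs = v ∷ vs} <vs@(v<vs ∷ <vs′) us ls ds g with locate <vs us ls ds g
... | inj₁ (t , p∈) with ys , zs , refl ← ∈-∃++ p∈ = starting t g′
  where
  g′ : Good (v ∷ vs) (us , ls , (v , t) ∷ ys ++ zs)
  g′ = good-resp-↭ (shift (v , t) ys zs) g
  starting : ∀ t → Good (v ∷ vs) (us , ls , (v , t) ∷ ys ++ zs) →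
    Decoding (v ∷ vs) (us , ls , ys ++ (v , t) ∷ zs)
  -- A whole path awaits an upper first edge, so it cannot stop at its first vertex.
  starting [] g with (_ , ()) ∷ _ ← g .tidy .proper
  starting (h ∷ t) g
    with w , ds′ , eq , ds↭ ← decoding <vs′ ((h , t) ∷ us) ls (ys ++ zs)
           (detached-good (start-attached v ((h , t) ∷ us , ls , ys ++ zs)) v<vs g)
    = start w , _ , cong (startAt v) eq , ↭-trans (shift _ ys zs) (prep _ ds↭)
decoding {vs = v ∷ vs} <vs@(v<vs ∷ <vs′) us@((h , t) ∷ us′) ls ds g | inj₂ (inj₁ v∈)
  with refl ← least-first (g .planar upper .nested)
    (head-minimal v<vs
      (∈-resp-↭ (g .tidy .covers) (head∈-verts upper (us , ls , ds) (here refl)))) v∈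
  with t
... | [] with w , ds′ , eq , ds↭ ← decoding <vs′ us′ ls ds (unfinish-good (us′ , ls , ds) g)
  = finish w , ds′ , cong (finishAt v) eq , ds↭
... | h′ ∷ t′ with w , ds′ , eq , ds↭ ← decoding <vs′ us′ ((h′ , t′) ∷ ls) ds
         (detached-good (down-attached v (us′ , (h′ , t′) ∷ ls , ds)) v<vs g)
  = down w , ds′ , cong (downAt v) eq , ds↭
decoding {vs = v ∷ vs} <vs@(v<vs ∷ <vs′) us ls@((h , t) ∷ ls′) ds g | inj₂ (inj₂ v∈)
  with refl ← least-first (g .planar lower .nested)
    (head-minimal v<vs
      (∈-resp-↭ (g .tidy .covers) (head∈-verts lower (us , ls , ds) (here refl)))) v∈
  with t
-- A path stopping here would have a lower last edge.
... | [] with (_ , ()) ∷ _ ← tidy-resp-↭ (strands-lower _ us ls′ ds) (g .tidy) .proper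
... | h′ ∷ t′ with w , ds′ , eq , ds↭ ← decoding <vs′ ((h′ , t′) ∷ us) ls′ ds
         (detached-good (up-attached v ((h′ , t′) ∷ us , ls′ , ds)) v<vs g)
  = up w , ds′ , cong (upAt v) eq , ds↭

-- Recovering the walk from the graph

Arc : State m u l → Fin m → Fin m → Set
Arc st a b = ∃ λ s → (a , b , s) ∈ arcs (strands st)

-- The graph shows the arcs but not their sides. The heads are included to make the relation survive
-- the removal of a vertex; when nothing is cut they are empty.
record Similar (st st′ : State m u l) : Set where
  field
    same-heads : ∀ s → heads s st ≡ heads s st′
    arcs-to    : ∀ {a b} → Arc st a b → Arc st′ a b
    arcs-from  : ∀ {a b} → Arc st′ a b → Arc st a b

open Similar

similar-sym : {st st′ : State m u l} → Similar st st′ → Similar st′ st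
similar-sym σ = record
  { same-heads = sym ∘ σ .same-heads ; arcs-to = σ .arcs-from ; arcs-from = σ .arcs-to }

module _ {b} {st₁ st₂ : State m u l} {st₁⁺ st₂⁺ : State m u′ l′}
  (att₁ : Attached v s b st₁ st₁⁺) (att₂ : Attached v s b st₂ st₂⁺)
  (below₁ : Below v (arcs (strands st₁))) (below₂ : Below v (arcs (strands st₂))) where

  -- All other arcs start to the right of `v`, so the one arc starting at `v` is recognisable
  -- without knowing its side.
  detach-next : (∀ {a b} → Arc st₁⁺ a b → Arc st₂⁺ a b) → att₁ .next ≡ att₂ .next
  detach-next to with _ , e ← to (_ , ∈-resp-↭ (↭-sym (attached-arcs att₁)) (here refl))
    with ∈-resp-↭ (attached-arcs att₂) e
  ... | here refl = refl
  ... | there e′  = ⊥-elim (Fin.<-irrefl refl (below₂ e′))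

  detach-arcs : (∀ {a b} → Arc st₁⁺ a b → Arc st₂⁺ a b) → ∀ {a b} → Arc st₁ a b → Arc st₂ a b
  detach-arcs to (_ , e) with _ , e⁺ ← to (_ , ∈-resp-↭ (↭-sym (attached-arcs att₁)) (there e))
    with ∈-resp-↭ (attached-arcs att₂) e⁺
  ... | here refl = ⊥-elim (Fin.<-irrefl refl (below₁ e))
  ... | there e′  = _ , e′

  detach-heads : Similar st₁⁺ st₂⁺ → ∀ s → heads s st₁ ≡ heads s st₂
  detach-heads σ = by-sides s
    (begin
      heads s st₁                 ≡⟨ att₁ .heads-same ⟩
      att₁ .next ∷ heads s st₁⁺   ≡⟨ cong₂ _∷_ (detach-next (σ .arcs-to)) (σ .same-heads s) ⟩
      att₂ .next ∷ heads s st₂⁺   ≡⟨ att₂ .heads-same ⟨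
      heads s st₂                 ∎)
    (List.++-cancelˡ (incoming b v) _ _ (begin
      incoming b v ++ heads (opposite s) st₁  ≡⟨ att₁ .heads-other ⟨
      heads (opposite s) st₁⁺                 ≡⟨ σ .same-heads (opposite s) ⟩
      heads (opposite s) st₂⁺                 ≡⟨ att₂ .heads-other ⟩
      incoming b v ++ heads (opposite s) st₂  ∎))
    where open ≡-Reasoning

detach-similar : ∀ {b} {st₁ st₂ : State m u l} {st₁⁺ st₂⁺ : State m u′ l′} →
  Attached v s b st₁ st₁⁺ → Attached v s b st₂ st₂⁺ →
  Below v (arcs (strands st₁)) → Below v (arcs (strands st₂)) →
  Similar st₁⁺ st₂⁺ → Similar st₁ st₂
detach-similar att₁ att₂ below₁ below₂ σ = record
  { same-heads = detach-heads att₁ att₂ below₁ below₂ σ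
  ; arcs-to    = detach-arcs att₁ att₂ below₁ below₂ (σ .arcs-to)
  ; arcs-from  = detach-arcs att₂ att₁ below₂ below₁ (σ .arcs-from)
  }

unfinish-similar : (st st′ : State m u l) → Similar (finishAt v st) (finishAt v st′) → Similar st st′
unfinish-similar {v = v} st st′ σ = record
  { same-heads = λ { upper → List.∷-injectiveʳ (σ .same-heads upper) ; lower → σ .same-heads lower }
  ; arcs-to    = λ (s , e) → down-to st′ (σ .arcs-to (s , ∈-resp-↭ (↭-sym (finish-arcs v st)) e))
  ; arcs-from  = λ (s , e) → down-to st (σ .arcs-from (s , ∈-resp-↭ (↭-sym (finish-arcs v st′)) e))
  }
  where
  down-to : ∀ st {a b} → Arc (finishAt v st) a b → Arc st a b
  down-to st (s , e) = s , ∈-resp-↭ (finish-arcs v st) e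

attached-∉ : ∀ {b} {st : State m u l} {st⁺ : State m u′ l′} → Attached v s b st st⁺ →
  v ∉ heads s st → v ∉ heads s st⁺
attached-∉ {v = v} att v∉ v∈ = v∉ (subst (v ∈_) (sym (att .heads-same)) (there v∈))

attached-∈ : {st : State m u l} {st⁺ : State m u′ l′} → Attached v s true st st⁺ →
  v ∈ heads (opposite s) st⁺
attached-∈ {v = v} att = subst (v ∈_) (sym (att .heads-other)) (here refl)

heads-clash : ∀ s {st st′ : State m u l} → v ∈ heads s st → v ∉ heads s st′ → ¬ Similar st st′
heads-clash {v = v} s v∈ v∉ σ = v∉ (subst (v ∈_) (σ .same-heads s) v∈)

-- The first step can be read off: after `start` no cut arc ends at `v`, after `up` a lower one
-- does, after `finish` or `down` an upper one does, and of these two only `down` has an arc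
-- starting at `v`. Equal first steps are peeled off and the induction goes on.
walk-injective : AllPairs _<_ vs → (w w′ : Walk vs u l) → Similar (decode w) (decode w′) → w ≡ w′
walk-injective {vs = []}     <vs           nil nil σ = refl
walk-injective {vs = v ∷ vs} (v<vs ∷ <vs) = inj
  where
  below : (w : Walk vs u l) → Below v (arcs (strands (decode w)))
  below w = arcs-above v<vs (decode w) (decode-good <vs w .tidy)

  fresh : ∀ s (w : Walk vs u l) → v ∉ heads s (decode w)
  fresh s w v∈ = Fin.<-irrefl refl (heads-above v<vs (decode w) (decode-good <vs w .tidy) s v∈)

  start-∉ : ∀ s (w : Walk vs (suc u) l) → v ∉ heads s (startAt v (decode w))
  start-∉ upper w = attached-∉ (start-attached v (decode w)) (fresh upper w)
  start-∉ lower w v∈ = fresh lower w (subst (v ∈_) (start-attached v (decode w) .heads-other) v∈)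

  up-∉ : ∀ (w : Walk vs (suc u) l) → v ∉ heads upper (upAt v (decode w))
  up-∉ w = attached-∉ (up-attached v (decode w)) (fresh upper w)

  down-∈ : (w : Walk vs u (suc l)) → v ∈ heads upper (downAt v (decode w))
  down-∈ w = attached-∈ (down-attached v (decode w))

  up-∈ : (w : Walk vs (suc u) l) → v ∈ heads lower (upAt v (decode w))
  up-∈ w = attached-∈ (up-attached v (decode w))

  down-finish : (w : Walk vs u (suc l)) (w′ : Walk vs u l) →
    ¬ Similar (downAt v (decode w)) (finishAt v (decode w′))
  down-finish w w′ σ
    with _ , e ← σ .arcs-to
           (_ , ∈-resp-↭ (↭-sym (attached-arcs (down-attached v (decode w)))) (here refl))
    = Fin.<-irrefl refl (below w′ (∈-resp-↭ (finish-arcs v (decode w′)) e))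

  inj : (w w′ : Walk (v ∷ vs) u l) → Similar (decode w) (decode w′) → w ≡ w′
  inj (start w) (start w′) σ = cong start (walk-injective <vs w w′
    (detach-similar (start-attached v _) (start-attached v _) (below w) (below w′) σ))
  inj (finish w) (finish w′) σ = cong finish (walk-injective <vs w w′ (unfinish-similar _ _ σ))
  inj (down w) (down w′) σ = cong down (walk-injective <vs w w′
    (detach-similar (down-attached v _) (down-attached v _) (below w) (below w′) σ))
  inj (up w) (up w′) σ = cong up (walk-injective <vs w w′
    (detach-similar (up-attached v _) (up-attached v _) (below w) (below w′) σ))
  inj (start w) (finish w′) σ = ⊥-elim (heads-clash upper (here refl) (start-∉ upper w) (similar-sym σ))
  inj (start w) (down w′)   σ = ⊥-elim (heads-clash upper (down-∈ w′) (start-∉ upper w) (similar-sym σ))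
  inj (start w) (up w′)     σ = ⊥-elim (heads-clash lower (up-∈ w′) (start-∉ lower w) (similar-sym σ))
  inj (finish w) (start w′) σ = ⊥-elim (heads-clash upper (here refl) (start-∉ upper w′) σ)
  inj (down w) (start w′)   σ = ⊥-elim (heads-clash upper (down-∈ w) (start-∉ upper w′) σ)
  inj (up w) (start w′)     σ = ⊥-elim (heads-clash lower (up-∈ w) (start-∉ lower w′) σ)
  inj (finish w) (up w′)    σ = ⊥-elim (heads-clash upper (here refl) (up-∉ w′) σ)
  inj (down w) (up w′)      σ = ⊥-elim (heads-clash upper (down-∈ w) (up-∉ w′) σ)
  inj (up w) (finish w′)    σ = ⊥-elim (heads-clash upper (here refl) (up-∉ w) (similar-sym σ))
  inj (up w) (down w′)      σ = ⊥-elim (heads-clash upper (down-∈ w′) (up-∉ w) (similar-sym σ))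
  inj (down w) (finish w′)  σ = ⊥-elim (down-finish w w′ σ)
  inj (finish w) (down w′)  σ = ⊥-elim (down-finish w′ w (similar-sym σ))

-- Enumeration of the walks

mutual
  walks : (vs : List (Fin m)) (u l : ℕ) → List (Walk vs u l)
  walks []       zero    zero    = nil ∷ []
  walks []       zero    (suc l) = []
  walks []       (suc u) l       = []
  walks (v ∷ vs) u       l       =
    map start (walks vs (suc u) l) ++ closing-walks v vs u l ++ up-walks v vs u l

  closing-walks : ∀ (v : Fin m) vs u l → List (Walk (v ∷ vs) u l)
  closing-walks v vs zero    l = []
  closing-walks v vs (suc u) l = map finish (walks vs u l) ++ map down (walks vs u (suc l))

  up-walks : ∀ (v : Fin m) vs u l → List (Walk (v ∷ vs) u l)
  up-walks v vs u zero    = []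
  up-walks v vs u (suc l) = map up (walks vs (suc u) l)

mutual
  length-walks : ∀ (vs : List (Fin m)) u l → length (walks vs u l) ≡ count (length vs) u l
  length-walks []       zero    zero    = refl
  length-walks []       zero    (suc l) = refl
  length-walks []       (suc u) l       = refl
  length-walks (v ∷ vs) u       l       = begin
    length (map start (walks vs (suc u) l) ++ closing-walks v vs u l ++ up-walks v vs u l)
      ≡⟨ List.length-++ (map start (walks vs (suc u) l)) ⟩
    length (map start (walks vs (suc u) l)) + length (closing-walks v vs u l ++ up-walks v vs u l)
      ≡⟨ cong₂ _+_ (trans (List.length-map start (walks vs (suc u) l)) (length-walks vs (suc u) l))
           (trans (List.length-++ (closing-walks v vs u l))
             (cong₂ _+_ (length-closing-walks v vs u l) (length-up-walks v vs u l))) ⟩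
    count (suc (length vs)) u l ∎
    where open ≡-Reasoning

  length-closing-walks : ∀ (v : Fin m) vs u l →
    length (closing-walks v vs u l) ≡ closings (length vs) u l
  length-closing-walks v vs zero    l = refl
  length-closing-walks v vs (suc u) l = trans (List.length-++ (map finish (walks vs u l)))
    (cong₂ _+_ (trans (List.length-map finish (walks vs u l)) (length-walks vs u l))
               (trans (List.length-map down (walks vs u (suc l))) (length-walks vs u (suc l))))

  length-up-walks : ∀ (v : Fin m) vs u l → length (up-walks v vs u l) ≡ ups (length vs) u l
  length-up-walks v vs u zero    = refl
  length-up-walks v vs u (suc l) =
    trans (List.length-map up (walks vs (suc u) l)) (length-walks vs (suc u) l)

∈-walks : (w : Walk vs u l) → w ∈ walks vs u l
∈-walks nil = here refl
∈-walks (start w) = ∈-++⁺ˡ (∈-map⁺ start (∈-walks w))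
∈-walks {vs = v ∷ vs} {l = l} (finish {u = u} w) =
  ∈-++⁺ʳ (map start (walks vs (suc (suc u)) l)) (∈-++⁺ˡ (∈-++⁺ˡ (∈-map⁺ finish (∈-walks w))))
∈-walks {vs = v ∷ vs} {l = l} (down {u = u} w) =
  ∈-++⁺ʳ (map start (walks vs (suc (suc u)) l)) (∈-++⁺ˡ
    (∈-++⁺ʳ (map finish (walks vs u l)) (∈-map⁺ down (∈-walks w))))
∈-walks {vs = v ∷ vs} {u = u} (up {l = l} w) =
  ∈-++⁺ʳ (map start (walks vs (suc u) (suc l))) (∈-++⁺ʳ (closing-walks v vs u (suc l))
    (∈-map⁺ up (∈-walks w)))

-- This and the next two lemmas separate the groups of walks by their first step. Only `suc u` needs
-- a clause, since no walk closes an upper arc at `zero`.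
start-∉-closing : ∀ {u} {w : Walk vs (suc u) l} → start w ∉ closing-walks v vs u l
start-∉-closing {vs = vs} {l} {u = suc u} w∈ with ∈-++⁻ (map finish (walks vs u l)) w∈
... | inj₁ w∈ˡ with () ← proj₂ (proj₂ (∈-map⁻ finish w∈ˡ))
... | inj₂ w∈ʳ with () ← proj₂ (proj₂ (∈-map⁻ down w∈ʳ))

start-∉-up : ∀ {l} {w : Walk vs (suc u) l} → start w ∉ up-walks v vs u l
start-∉-up {l = suc l} w∈ with () ← proj₂ (proj₂ (∈-map⁻ up w∈))

up-∉-closing : ∀ {u} {w : Walk vs (suc u) l} → up w ∉ closing-walks v vs u (suc l)
up-∉-closing {vs = vs} {l} {u = suc u} w∈ with ∈-++⁻ (map finish (walks vs u (suc l))) w∈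
... | inj₁ w∈ˡ with () ← proj₂ (proj₂ (∈-map⁻ finish w∈ˡ))
... | inj₂ w∈ʳ with () ← proj₂ (proj₂ (∈-map⁻ down w∈ʳ))

mutual
  walks-unique : ∀ (vs : List (Fin m)) u l → Unique (walks vs u l)
  walks-unique []       zero    zero    = [] ∷ []
  walks-unique []       zero    (suc l) = []
  walks-unique []       (suc u) l       = []
  walks-unique (v ∷ vs) u       l       =
    Unique.++⁺ (Unique.map⁺ (λ { refl → refl }) (walks-unique vs (suc u) l))
      (Unique.++⁺ (closing-unique v vs u l) (up-unique v vs u l) (closing-up l))
      start-others
    where
    closing-up : ∀ l {w} → ¬ (w ∈ closing-walks v vs u l × w ∈ up-walks v vs u l)
    closing-up (suc l) (w∈ , w∈′) with _ , _ , refl ← ∈-map⁻ up w∈′ = up-∉-closing w∈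
    start-others : ∀ {w} → ¬ (w ∈ map start (walks vs (suc u) l) ×
                              w ∈ closing-walks v vs u l ++ up-walks v vs u l)
    start-others (w∈ , w∈′) with _ , _ , refl ← ∈-map⁻ start w∈
      with ∈-++⁻ (closing-walks v vs u l) w∈′
    ... | inj₁ w∈ˡ = start-∉-closing w∈ˡ
    ... | inj₂ w∈ʳ = start-∉-up w∈ʳ

  closing-unique : ∀ (v : Fin m) vs u l → Unique (closing-walks v vs u l)
  closing-unique v vs zero    l = []
  closing-unique v vs (suc u) l =
    Unique.++⁺ (Unique.map⁺ (λ { refl → refl }) (walks-unique vs u l))
      (Unique.map⁺ (λ { refl → refl }) (walks-unique vs u (suc l)))
      finish-down
    where
    finish-down : ∀ {w} → ¬ (w ∈ map finish (walks vs u l) × w ∈ map down (walks vs u (suc l)))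
    finish-down (w∈ , w∈′) with _ , _ , refl ← ∈-map⁻ finish w∈
      with () ← proj₂ (proj₂ (∈-map⁻ down w∈′))

  up-unique : ∀ (v : Fin m) vs u l → Unique (up-walks v vs u l)
  up-unique v vs u zero    = []
  up-unique v vs u (suc l) = Unique.map⁺ (λ { refl → refl }) (walks-unique vs (suc u) l)

-- Walks and graphs

open Equivalence using (to; from)

_≟ˢ_ : DecidableEquality Side
upper ≟ˢ upper = yes refl
upper ≟ˢ lower = no λ ()
lower ≟ˢ upper = no λ ()
lower ≟ˢ lower = yes refl

-- Has the very form of the adjacency condition in `IsPSWG`, so the two agree by unfolding.
Joined : List (Edge m) → Fin m → Fin m → Set
Joined E i j = ∃ λ s → ((i , j , s) ∈ E) ⊎ ((j , i , s) ∈ E)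

joined? : ∀ (E : List (Edge m)) i j → Dec (Joined E i j)
joined? E i j = map′ (λ { (inj₁ e) → upper , e ; (inj₂ e) → lower , e })
  (λ { (upper , e) → inj₁ e ; (lower , e) → inj₂ e }) (joined-in? upper ⊎-dec joined-in? lower)
  where
  open DecMembership (Product.≡-dec Fin._≟_ (Product.≡-dec Fin._≟_ _≟ˢ_)) using (_∈?_)
  joined-in? : ∀ s → Dec ((i , j , s) ∈ E ⊎ (j , i , s) ∈ E)
  joined-in? s = ((i , j , s) ∈? E) ⊎-dec ((j , i , s) ∈? E)

graphOf : List (Edge m) → Graph m
graphOf E = tabulate λ i → tabulate λ j → ⌊ joined? E i j ⌋

adjacent-graphOf : ∀ (E : List (Edge m)) i j → Adjacent (graphOf E) i j ⇔ Joined E i j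
adjacent-graphOf E i j
  rewrite Vec.lookup∘tabulate (λ i → tabulate λ j → ⌊ joined? E i j ⌋) i
        | Vec.lookup∘tabulate (λ j → ⌊ joined? E i j ⌋) j = mk⇔ toWitness fromWitness

lookup-ext : ∀ {A : Set} {n} (xs ys : Vec A n) → (∀ i → lookup xs i ≡ lookup ys i) → xs ≡ ys
lookup-ext xs ys eq = begin
  xs                    ≡⟨ Vec.tabulate∘lookup xs ⟨
  tabulate (lookup xs)  ≡⟨ Vec.tabulate-cong eq ⟩
  tabulate (lookup ys)  ≡⟨ Vec.tabulate∘lookup ys ⟩
  ys                    ∎
  where open ≡-Reasoning

graph-ext : (G H : Graph m) → (∀ i j → Adjacent G i j ⇔ Adjacent H i j) → G ≡ H
graph-ext G H G⇔H = lookup-ext G H λ i → lookup-ext _ _ λ j → T-ext (G⇔H i j)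
  where
  T-ext : ∀ {b c} → T b ⇔ T c → b ≡ c
  T-ext {false} {false} _ = refl
  T-ext {false} {true}  e = ⊥-elim (from e tt)
  T-ext {true}  {false} e = ⊥-elim (to e tt)
  T-ext {true}  {true}  _ = refl

-- Wave graphs as drawings without cut arcs

last-upper : ∀ s (h x : Fin m) t →
  lastSide (last (drawPath s (h ∷ x ∷ t))) ≡ just upper ⇔ Ends s (x ∷ t)
last-upper upper h x []      = mk⇔ _ λ _ → refl
last-upper lower h x []      = mk⇔ (λ ()) λ ()
last-upper s     h x (y ∷ t) = last-upper (opposite s) x y t

-- The bound on the length is absorbed by `Ends`: `Ends upper []` is empty, which excludes isolated
-- vertices.
valid⇔proper : (p : Path m) → ValidPath (vertices p) ⇔ Proper (upper , p)
valid⇔proper (h , [])    = mk⇔ (λ { (s≤s () , _) }) λ ()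
valid⇔proper (h , x ∷ t) = mk⇔
  (λ (_ , lk , e) → lk , to (last-upper upper h x t) e)
  (λ (lk , e) → s≤s (s≤s z≤n) , lk , from (last-upper upper h x t) e)

valid-paths : (ps : List (List (Fin m))) → All ValidPath ps →
  ∃ λ ds → ps ≡ map vertices ds × All Proper (map (upper ,_) ds)
valid-paths []              []        = [] , refl , []
valid-paths ([] ∷ ps)       ((() , _) ∷ _)
valid-paths ((h ∷ t) ∷ ps) (vp ∷ vps) with ds , refl , pds ← valid-paths ps vps =
  (h , t) ∷ ds , refl , to (valid⇔proper (h , t)) vp ∷ pds

proper-paths : (ds : List (Path m)) → All Proper (map (upper ,_) ds) →
  All ValidPath (map vertices ds)
proper-paths []       []        = []
proper-paths (d ∷ ds) (p ∷ ps) = from (valid⇔proper d) p ∷ proper-paths ds ps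

whole : List (Path m) → State m 0 0
whole ds = [] , [] , ds

verts-whole : (ds : List (Path m)) → verts (strands (whole ds)) ≡ concat (map vertices ds)
verts-whole []       = refl
verts-whole (d ∷ ds) = cong (vertices d ++_) (verts-whole ds)

arcs-whole : (ds : List (Path m)) →
  arcs (strands (whole ds)) ≡ concatMap (drawPath upper) (map vertices ds)
arcs-whole []       = refl
arcs-whole (d ∷ ds) = cong (drawPath upper (vertices d) ++_) (arcs-whole ds)

Drawn : Graph m → List (Path m) → Set
Drawn {m} G ds = Good (allFin m) (whole ds) ×
  (∀ i j → Adjacent G i j ⇔ Joined (arcs (strands (whole ds))) i j)

drawn⇒pswg : (G : Graph m) (ds : List (Path m)) → Drawn G ds → IsPSWG G
drawn⇒pswg G ds (g , adj) =
    map vertices ds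
  , subst (_↭ _) (verts-whole ds) (g .tidy .covers)
  , proper-paths ds (subst (All Proper) (List.++-identityʳ _) (g .tidy .proper))
  , subst (λ E → ∀ i j → Adjacent G i j ⇔ Joined E i j) (arcs-whole ds) adj
  , subst (λ E → ∀ a b c d s → (a , b , s) ∈ E → (c , d , s) ∈ E → ¬ Interleave a b c d)
      (arcs-whole ds) (λ _ _ _ _ s → g .planar s .uncrossed)

pswg⇒drawn : (G : Graph m) → IsPSWG G → ∃ (Drawn G)
pswg⇒drawn G (ps , covers′ , valid , adj , unc)
  with ds , refl , proper′ ← valid-paths ps valid
  = ds , g , subst (λ E → ∀ i j → Adjacent G i j ⇔ Joined E i j) (sym (arcs-whole ds)) adj
  where
  pl : ∀ s → Planar s (arcs (strands (whole ds))) []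
  pl s rewrite arcs-whole ds = record { uncrossed = unc _ _ _ _ s ; nested = [] ; visible = λ () }
  g : Good (allFin _) (whole ds)
  g = record
    { tidy = record
      { covers = subst (_↭ _) (sym (verts-whole ds)) covers′
      ; proper = subst (All Proper) (sym (List.++-identityʳ _)) proper′ }
    ; planar = λ { upper → pl upper ; lower → pl lower } }

-- The bijection between walks and graphs

drawPath-increasing : ∀ {a b : Fin m} {s} s′ {p} → Linked _<_ p → (a , b , s) ∈ drawPath s′ p → a < b
drawPath-increasing s′ (a<b ∷ _)  (here refl) = a<b
drawPath-increasing s′ (_   ∷ lk) (there e)   = drawPath-increasing (opposite s′) lk e

arcs-increasing : {qs : List (Strand m)} → Tidy vs qs →
  ∀ {a b s} → (a , b , s) ∈ arcs qs → a < b
arcs-increasing {qs = qs} tidy′ e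
  with (s , p) , q∈ , e′ ← find (∈-concatMap⁻ _ {xs = qs} e)
  = drawPath-increasing s (proj₁ (All.lookup (tidy′ .proper) q∈)) e′

graph : {vs : List (Fin m)} → Walk vs u l → Graph m
graph w = graphOf (arcs (strands (decode w)))

-- Adjacency is symmetric, but arcs run from left to right, which restores the orientation; only the
-- side is lost.
graph-arcs : AllPairs _<_ vs → (w w′ : Walk vs u l) → graph w ≡ graph w′ →
  ∀ {a b} → Arc (decode w) a b → Arc (decode w′) a b
graph-arcs <vs w w′ eq {a} {b} (s , e)
  with to (adjacent-graphOf _ a b) (subst (λ G → Adjacent G a b) eq
         (from (adjacent-graphOf _ a b) (s , inj₁ e)))
... | s′ , inj₁ e′ = s′ , e′
... | s′ , inj₂ e′ = ⊥-elim (Fin.<-asym (arcs-increasing (decode-good <vs w .tidy) e)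
                                       (arcs-increasing (decode-good <vs w′ .tidy) e′))

no-heads : ∀ s (st : State m 0 0) → heads s st ≡ []
no-heads upper ([] , [] , _) = refl
no-heads lower ([] , [] , _) = refl

graph-injective : AllPairs _<_ vs → {w w′ : Walk vs 0 0} → graph w ≡ graph w′ → w ≡ w′
graph-injective <vs {w} {w′} eq = walk-injective <vs w w′ record
  { same-heads = λ s → trans (no-heads s (decode w)) (sym (no-heads s (decode w′)))
  ; arcs-to    = graph-arcs <vs w w′ eq
  ; arcs-from  = graph-arcs <vs w′ w (sym eq)
  }

allFin-increasing : ∀ m → AllPairs _<_ (allFin m)
allFin-increasing m = AllPairs.tabulate⁺-< λ i<j → i<j

graph-pswg : (w : Walk (allFin m) 0 0) → IsPSWG (graph w)
-- Abstracting the decoded state together with its goodness allows both vectors of cut paths to be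
-- matched as empty.
graph-pswg w with decode w | decode-good (allFin-increasing _) w
... | [] , [] , ds | g = drawn⇒pswg (graphOf E) ds (g , adjacent-graphOf E)
  where E = arcs (strands (whole ds))

-- The walk may list the paths in another order than the given drawing, but a permutation of the
-- arcs does not change adjacency.
pswg-graph : (G : Graph m) → IsPSWG G → ∃ λ (w : Walk (allFin m) 0 0) → G ≡ graph w
pswg-graph G pswg with ds , g , adj ← pswg⇒drawn G pswg
  with w , ds′ , eq , ds↭ ← decoding (allFin-increasing _) [] [] ds g =
  w , graph-ext _ _ λ i j →
    ⇔-trans (adj i j) (⇔-trans (joined i j) (⇔-sym (adjacent-graphOf _ i j)))
  where
  E = arcs (strands (whole ds))
  E′ = arcs (strands (decode w))
  E↭E′ : E ↭ E′
  E↭E′ = subst (λ st → E ↭ arcs (strands st)) (sym eq)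
    (concatMap-↭ _ (++⁺ʳ _ (map⁺ _ ds↭)))
  joined-↭ : ∀ {E E′ i j} → E ↭ E′ → Joined E i j → Joined E′ i j
  joined-↭ E↭ (s , inj₁ e) = s , inj₁ (∈-resp-↭ E↭ e)
  joined-↭ E↭ (s , inj₂ e) = s , inj₂ (∈-resp-↭ E↭ e)
  joined : ∀ i j → Joined E i j ⇔ Joined E′ i j
  joined i j = mk⇔ (joined-↭ E↭E′) (joined-↭ (↭-sym E↭E′))

pswg-count : ∀ m → HasCount (IsPSWG {m}) (count m 0 0)
pswg-count m =
    map graph (walks (allFin m) 0 0)
  , Unique.map⁺ (graph-injective (allFin-increasing m)) (walks-unique (allFin m) 0 0)
  , (λ G → mk⇔ (sound G) (complete G))
  , (begin
      length (map graph (walks (allFin m) 0 0))  ≡⟨ List.length-map graph (walks (allFin m) 0 0) ⟩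
      length (walks (allFin m) 0 0)              ≡⟨ length-walks (allFin m) 0 0 ⟩
      count (length (allFin m)) 0 0
        ≡⟨ cong (λ n → count n 0 0) (List.length-tabulate (λ (i : Fin m) → i)) ⟩
      count m 0 0                                ∎)
  where
  open ≡-Reasoning
  sound : ∀ G → G ∈ map graph (walks (allFin m) 0 0) → IsPSWG G
  sound G G∈ with w , _ , refl ← ∈-map⁻ graph G∈ = graph-pswg w
  complete : ∀ G → IsPSWG G → G ∈ map graph (walks (allFin m) 0 0)
  complete G pswg with w , refl ← pswg-graph G pswg = ∈-map⁺ graph (∈-walks w)

theorem30 : (k : ℕ) → 1 ≤ k →
    Σ ℕ λ N → HasCount (IsPSWG {2 * k}) N
    × N * ((k !) * ((k + 1) !) * ((k + 2) !) * ((k + 3) !))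
    ≡ ((2 * k) !) * ((2 * k + 2) !) * 6
theorem30 k _ = count (2 * k) 0 0 , pswg-count (2 * k) , formula
  where
  formula : count (2 * k) 0 0 * ((k !) * ((k + 1) !) * ((k + 2) !) * ((k + 3) !))
    ≡ ((2 * k) !) * ((2 * k + 2) !) * 6
  -- At the origin the slack is all of `2 * k`, so `m` is `k`. With the constants moved to the
  -- front, the factorials on the left compute to `weight 0 0 k`, and the 6 is `dim 0 0`.
  formula rewrite ℕ.+-comm k 1 | ℕ.+-comm k 2 | ℕ.+-comm k 3 | ℕ.+-comm (2 * k) 2 =
    count-formula (2 * k) 0 0 k refl
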